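{- Let $F$ be a binary format descriptor with IEEE exceptional encodings and conventional bias $b=2^{e_w-1}-1$ (where $e_w\ge 2$ is the exponent-field width and $f_w>0$ the fraction-field width). Let $x,y$ be finite encoded words of $F$ whose real values $u=\operatorname{val}_F(x)$ and $v=\operatorname{val}_F(y)$ are positive. If $u\le 2v$ and $v\le 2u$, then the reference subtraction satisfies $$\operatorname{val}_F(S_F^{ - }(x,y))=u-v.$$ (No assumption that $S_F^{ - }(x,y)$ is finite is made.)
   Context: Encoded words. A word of $F$ is a bit vector of width $1+e_w+f_w$, split into a sign bit $s$, an exponent field $E\in[0,2^{e_w})$ and a fraction field $M\in[0,2^{f_w})$. With IEEE exceptional encodings: if $E=2^{e_w}-1$ the word is an infinity (when $M=0$) or a NaN (when $M\ne0$); every other word is finite. A finite word decodes to the signed dyadic $(-1)^s m2^{q}$ with $(m,q)=(M,\,1-b-f_w)$ if $E=0$ and $(m,q)=(2^{f_w}+M,\;E-b-f_w)$ if $E\ge1$. The real interpretation $\operatorname{val}_F(w)\in\mathbb{R}$ is the real number $(-1)^sm2^q$ for finite $w$ (forgetting the sign of zero), and is $0$ for nonfinite $w$. Packing. For a signed dyadic $d=(-1)^s m2^q$ ($m\in\mathbb{N}$, $q\in\mathbb{Z}$), $\operatorname{roundDyadic}_F(d)$ is the word obtained by rounding once to nearest-even and packing: - if $m=0$, the zero with sign $s$; - otherwise let $\lambda=\lfloor\log_2 m\rfloor+q$. If $\lambda<1-b$ (subnormal range), let $k$ be $m2^{q-(1-b-f_w)}$ rounded to the nearest integer, ties to even; the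 result has sign $s$ and fields $(E,M)=(0,k)$ if $k<2^{f_w}$ and $(1,0)$ if $k=2^{f_w}$. - If $\lambda\ge 1-b$, let $k\in[2^{f_w},2^{f_w+1}]$ be $m2^{q-(\lambda-f_w)}$ rounded to the nearest integer, ties to even; if $k=2^{f_w+1}$, replace $(k,\lambda)$ by $(2^{f_w},\lambda+1)$. If then $\lambda>b$, the result is the infinity of sign $s$; otherwise it has sign $s$ and fields $(E,M)=(\lambda+b,\;k-2^{f_w})$. Reference subtraction. On finite operands, $S_F^{ - }(x,y)$ computes the exact dyadic difference and applies $\operatorname{roundDyadic}_F$ once (the sign chosen for an exact zero difference follows IEEE 754 and does not affect $\operatorname{val}_F$). -}

module Defs where

open import Data.Bool.Base using (Bool; true; false; if_then_else_)
open import Data.Integer.Base as ℤ using (ℤ; +_; -[1+_]; 0ℤ; 1ℤ; _◃_)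
import Data.Integer.Properties as ℤ
open import Data.Nat.Base as ℕ using (ℕ; zero; suc; _^_; _∸_)
import Data.Nat.Properties as ℕ
open import Data.Nat.Divisibility using (_∣?_)
open import Data.Nat.Logarithm using (⌊log₂_⌋)
open import Data.Product.Base using (_×_)
open import Data.Rational.Base as ℚ using (ℚ; 0ℚ; ½; floor)
import Data.Rational.Properties as ℚ
open import Data.Sign.Base as Sign using (Sign)
open import Data.Sum.Base using (_⊎_)
open import Data.Vec.Base using (Vec; []; _∷_; _++_; head; tail; take; drop)
open import Relation.Binary.Definitions using (tri<; tri≈; tri>)
open import Relation.Binary.PropositionalEquality
  using (_≡_; _≢_; refl; sym; trans; cong; subst)
open import Relation.Nullary.Decidable using (Dec; yes; no; does; ¬?; _×-dec_; _⊎-dec_)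
open import Relation.Nullary.Negation using (¬_)

------------------------------------------------------------------------
-- Unsigned bit vectors, most significant bit first

fromBit : Bool → ℕ
fromBit false = 0
fromBit true  = 1

fromBits : ∀ {n} → Vec Bool n → ℕ
fromBits         []       = 0
fromBits {suc n} (b ∷ bs) = fromBit b ℕ.* 2 ^ n ℕ.+ fromBits bs

-- Only meaningful for k < 2 ^ n; see fromBits-toBits.
toBits : ∀ n → ℕ → Vec Bool n
toBits zero    k = []
toBits (suc n) k with 2 ^ n ℕ.≤? k
... | yes _ = true  ∷ toBits n (k ∸ 2 ^ n)
... | no  _ = false ∷ toBits n k

fromBits-toBits : ∀ n {k} → k ℕ.< 2 ^ n → fromBits (toBits n k) ≡ k
fromBits-toBits zero    {zero} _ = refl
fromBits-toBits zero    {suc k} (ℕ.s≤s ())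
fromBits-toBits (suc n) {k} k<2ⁿ⁺¹ with 2 ^ n ℕ.≤? k
... | no  2ⁿ≰k = fromBits-toBits n (ℕ.≰⇒> 2ⁿ≰k)
... | yes 2ⁿ≤k = trans
  (cong (1 ℕ.* 2 ^ n ℕ.+_) (fromBits-toBits n k∸2ⁿ<2ⁿ))
  (trans (cong (ℕ._+ (k ∸ 2 ^ n)) (ℕ.*-identityˡ (2 ^ n))) (ℕ.m+[n∸m]≡n 2ⁿ≤k))
  where
  k∸2ⁿ<2ⁿ : k ∸ 2 ^ n ℕ.< 2 ^ n
  k∸2ⁿ<2ⁿ = ℕ.+-cancelˡ-< (2 ^ n) _ _
    (subst (ℕ._< 2 ^ n ℕ.+ 2 ^ n) (sym (ℕ.m+[n∸m]≡n 2ⁿ≤k))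
      (subst (λ z → k ℕ.< 2 ^ n ℕ.+ z) (ℕ.+-identityʳ (2 ^ n)) k<2ⁿ⁺¹))

fromSignBit : Bool → Sign
fromSignBit false = Sign.+
fromSignBit true  = Sign.-

toSignBit : Sign → Bool
toSignBit Sign.+ = false
toSignBit Sign.- = true

------------------------------------------------------------------------
-- Signed dyadics (-1)ˢ m 2^q.  The sign is stored separately so that
-- the two zeros remain distinct.

record Dyadic : Set where
  constructor dyadic
  field
    sign        : Sign
    significand : ℕ
    exponent    : ℤ

2^_ : ℤ → ℚ
2^ (+ n)    = + (2 ^ n) ℚ./ 1
2^ -[1+ n ] = (1ℤ ℚ./ 2 ^ suc n) {{ℕ.m^n≢0 2 (suc n)}}

⟦_⟧ : Dyadic → ℚ
⟦ dyadic s m q ⟧ = ((s ◃ m) ℚ./ 1) ℚ.* 2^ q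

-- Round to the nearest integer, ties to even.
roundEven : ℚ → ℤ
roundEven p with ℚ.<-cmp (p ℚ.- (floor p ℚ./ 1)) ½
... | tri< _ _ _ = floor p
... | tri≈ _ _ _ = if does (2 ∣? ℤ.∣ floor p ∣) then floor p else floor p ℤ.+ 1ℤ
... | tri> _ _ _ = floor p ℤ.+ 1ℤ

------------------------------------------------------------------------
-- Binary formats with IEEE exceptional encodings and conventional bias

record IEEEFormat : Set where
  field
    ew   : ℕ
    fw   : ℕ
    2≤ew : 2 ℕ.≤ ew
    0<fw : 0 ℕ.< fw

  bias : ℕ
  bias = 2 ^ (ew ∸ 1) ∸ 1

  maxE : ℕ
  maxE = 2 ^ ew ∸ 1

  Word : Set
  Word = Vec Bool (1 ℕ.+ ew ℕ.+ fw)

open IEEEFormat public using (Word)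

module _ (F : IEEEFormat) where
  open IEEEFormat F hiding (Word)

  signField : Word F → Sign
  signField w = fromSignBit (head w)

  exponentField : Word F → ℕ
  exponentField w = fromBits (take ew (tail w))

  fractionField : Word F → ℕ
  fractionField w = fromBits (drop ew (tail w))

  pack : Sign → (E M : ℕ) → Word F
  pack s E M = toSignBit s ∷ (toBits ew E ++ toBits fw M)

  IsInfinity : Word F → Set
  IsInfinity w = exponentField w ≡ maxE × fractionField w ≡ 0

  IsNaN : Word F → Set
  IsNaN w = exponentField w ≡ maxE × fractionField w ≢ 0

  IsFinite : Word F → Set
  IsFinite w = ¬ (IsInfinity w ⊎ IsNaN w)

  isFinite? : ∀ w → Dec (IsFinite w)
  isFinite? w = ¬? ((exponentField w ℕ.≟ maxE ×-dec fractionField w ℕ.≟ 0)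
               ⊎-dec (exponentField w ℕ.≟ maxE ×-dec ¬? (fractionField w ℕ.≟ 0)))

  decodeFields : Sign → (E M : ℕ) → Dyadic
  decodeFields s zero      M = dyadic s M              (1ℤ  ℤ.- + bias ℤ.- + fw)
  decodeFields s E@(suc _) M = dyadic s (2 ^ fw ℕ.+ M) (+ E ℤ.- + bias ℤ.- + fw)

  decode : (w : Word F) → .(IsFinite w) → Dyadic
  decode w _ = decodeFields (signField w) (exponentField w) (fractionField w)

  -- Every value is a dyadic rational, so ℚ stands in for the reals.
  val : Word F → ℚ
  val w with isFinite? w
  ... | yes fin = ⟦ decode w fin ⟧
  ... | no  _   = 0ℚ

  infinity : Sign → Word F
  infinity s = pack s maxE 0

  -- λ < 1 - b; here k ∈ [0, 2^fw].
  packSubnormal : Sign → (k : ℕ) → Word F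
  packSubnormal s k =
    if does (k ℕ.≟ 2 ^ fw) then pack s 1 0 else pack s 0 k

  -- Used only with l ≥ 1 - b, so that ∣ l + b ∣ is l + b.
  packChecked : Sign → (k : ℕ) (l : ℤ) → Word F
  packChecked s k l =
    if does (+ bias ℤ.<? l)
    then infinity s
    else pack s ℤ.∣ l ℤ.+ + bias ∣ (k ∸ 2 ^ fw)

  -- λ ≥ 1 - b; here k ∈ [2^fw, 2^(fw+1)], and the upper end renormalises.
  packNormal : Sign → (k : ℕ) (l : ℤ) → Word F
  packNormal s k l =
    if does (k ℕ.≟ 2 ^ suc fw)
    then packChecked s (2 ^ fw) (l ℤ.+ 1ℤ)
    else packChecked s k l

  -- The number m 2^(q - t), in units of 2^t, rounded to an integer.
  roundTo : (m : ℕ) (q t : ℤ) → ℕ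
  roundTo m q t = ℤ.∣ roundEven ((+ m ℚ./ 1) ℚ.* 2^ (q ℤ.- t)) ∣

  roundDyadic : Dyadic → Word F
  roundDyadic (dyadic s zero      q) = pack s 0 0
  roundDyadic (dyadic s m@(suc _) q) =
    let l = + ⌊log₂ m ⌋ ℤ.+ q in
    if does (l ℤ.<? 1ℤ ℤ.- + bias)
    then packSubnormal s (roundTo m q (1ℤ ℤ.- + bias ℤ.- + fw))
    else packNormal s (roundTo m q (l ℤ.- + fw)) l

------------------------------------------------------------------------
-- Exact dyadic difference

-- IEEE 754, round-to-nearest: an exact zero difference is +0, except
-- that (-0) - (+0) is -0.
zeroDiffSign : Sign → Sign → Sign
zeroDiffSign Sign.- Sign.+ = Sign.-
zeroDiffSign _      _      = Sign.+

diffSign : Sign → Sign → ℤ → Sign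
diffSign s₁ s₂ n = if does (n ℤ.≟ 0ℤ) then zeroDiffSign s₁ s₂ else ℤ.sign n

-- s ◃ m scaled to units of 2^t, for t ≤ q.
scaleTo : ℤ → Dyadic → ℤ
scaleTo t (dyadic s m q) = s ◃ (m ℕ.* 2 ^ ℤ.∣ q ℤ.- t ∣)

_⊖_ : Dyadic → Dyadic → Dyadic
d₁ ⊖ d₂ = dyadic (diffSign (Dyadic.sign d₁) (Dyadic.sign d₂) n) ℤ.∣ n ∣ t
  where
  t n : ℤ
  t = Dyadic.exponent d₁ ℤ.⊓ Dyadic.exponent d₂
  n = scaleTo t d₁ ℤ.- scaleTo t d₂

refSub : (F : IEEEFormat) (x y : Word F) → .(IsFinite F x) → .(IsFinite F y) → Word F
refSub F x y fx fy = roundDyadic F (decode F x fx ⊖ decode F y fy)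

module Submission where

-- Write both operands as integers X, Y in units of 2^t, where t is the
-- smaller of the two exponents; X ≤ 2Y and Y ≤ 2X give |X − Y| ≤ min(X, Y).
-- The operand of exponent t is its own significand there, so |X − Y| <
-- 2^(fw+1), while t lies in the exponent range of the format.  A dyadic with
-- these two properties needs no rounding and cannot overflow: its scaling to
-- the unit in which roundDyadic rounds is already an integer.

open import Defs
import Algebra.Properties.Group as GroupProperties
open import Data.Bool.Base using (Bool; true; false; if_then_else_)
open import Data.Integer.Base as ℤ using (ℤ; +_; -[1+_]; 0ℤ; 1ℤ; _◃_)
import Data.Integer.Properties as ℤ
import Data.Integer.Tactic.RingSolver as ℤ-Ring
open import Data.Nat.Base as ℕ using (ℕ; zero; suc; _^_; _∸_; NonZero; z≤n; s≤s; ⌊_/2⌋; ⌈_/2⌉)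
import Data.Nat.DivMod as ℕ
import Data.Nat.Coprimality as Coprime
open import Data.Nat.Induction using (<-rec)
open import Data.Nat.Logarithm
  using (⌊log₂_⌋; ⌊log₂⌋-mono-≤; ⌊log₂⌊n/2⌋⌋≡⌊log₂n⌋∸1; ⌊log₂[2^n]⌋≡n)
import Data.Nat.Properties as ℕ
open import Data.Product.Base using (_,_; proj₁; proj₂)
open import Data.Rational.Base as ℚ using (ℚ; mkℚ; ½; floor; 0ℚ; _/_; _*_; _-_; _<_; _≤_)
import Data.Rational.Properties as ℚ
open import Data.Rational.Unnormalised.Base as ℚᵘ using (mkℚᵘ; *≡*; *≤*)
import Data.Rational.Unnormalised.Properties as ℚᵘ
open import Data.Sign.Base as Sign using (Sign)
open import Data.Sign.Properties using (*-identityʳ)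
open import Data.Sum.Base using (inj₁; inj₂)
open import Data.Vec.Base using (Vec; []; _∷_; _++_; tail; take; drop)
open import Data.Vec.Properties using (++-injective; take++drop≡id)
open import Relation.Binary.Definitions using (tri<; tri≈; tri>)
open import Relation.Binary.PropositionalEquality
  using (_≡_; _≢_; refl; sym; trans; cong; cong₂; subst; subst₂; module ≡-Reasoning)
open import Relation.Nullary.Decidable using (Dec; yes; no; does; dec-false)
open import Relation.Nullary.Negation using (¬_; contradiction)

-- Branches on a decision buried in a goal, with the motive `C` given explicitly; each branch keeps
-- the proof or refutation that selected it.
if-does-elim : ∀ {A P : Set} (C : A → Set) (P? : Dec P) {x y} →
               (P → C x) → (¬ P → C y) → C (if does P? then x else y)
if-does-elim C (yes p) Cx Cy = Cx p
if-does-elim C (no ¬p) Cx Cy = Cy ¬p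

-- Integers as rationals

⌜_⌝ : ℤ → ℚ
⌜ i ⌝ = i / 1

-- `i / 1` is definitionally `fromℚᵘ (mkℚᵘ i 0)`, so arithmetic on quotients can be done on
-- unnormalised fractions, away from the gcds.
fromℚᵘ-homo-* : ∀ p q → ℚ.fromℚᵘ p * ℚ.fromℚᵘ q ≡ ℚ.fromℚᵘ (p ℚᵘ.* q)
fromℚᵘ-homo-* p q = ℚ.toℚᵘ-injective
  (ℚᵘ.≃-trans (ℚ.toℚᵘ-homo-* (ℚ.fromℚᵘ p) (ℚ.fromℚᵘ q))
  (ℚᵘ.≃-trans (ℚᵘ.*-cong (ℚ.toℚᵘ-fromℚᵘ p) (ℚ.toℚᵘ-fromℚᵘ q))
              (ℚᵘ.≃-sym (ℚ.toℚᵘ-fromℚᵘ (p ℚᵘ.* q)))))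

fromℚᵘ-homo-+ : ∀ p q → ℚ.fromℚᵘ p ℚ.+ ℚ.fromℚᵘ q ≡ ℚ.fromℚᵘ (p ℚᵘ.+ q)
fromℚᵘ-homo-+ p q = ℚ.toℚᵘ-injective
  (ℚᵘ.≃-trans (ℚ.toℚᵘ-homo-+ (ℚ.fromℚᵘ p) (ℚ.fromℚᵘ q))
  (ℚᵘ.≃-trans (ℚᵘ.+-cong (ℚ.toℚᵘ-fromℚᵘ p) (ℚ.toℚᵘ-fromℚᵘ q))
              (ℚᵘ.≃-sym (ℚ.toℚᵘ-fromℚᵘ (p ℚᵘ.+ q)))))

⌜⌝-homo-* : ∀ i j → ⌜ i ℤ.* j ⌝ ≡ ⌜ i ⌝ * ⌜ j ⌝
⌜⌝-homo-* i j = sym (fromℚᵘ-homo-* (mkℚᵘ i 0) (mkℚᵘ j 0))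

⌜⌝-homo-+ : ∀ i j → ⌜ i ℤ.+ j ⌝ ≡ ⌜ i ⌝ ℚ.+ ⌜ j ⌝
⌜⌝-homo-+ i j = trans
  (cong ⌜_⌝ (cong₂ ℤ._+_ (sym (ℤ.*-identityʳ i)) (sym (ℤ.*-identityʳ j))))
  (sym (fromℚᵘ-homo-+ (mkℚᵘ i 0) (mkℚᵘ j 0)))

-- `_/_` itself splits on the sign of the numerator and negates the positive quotient, which leaves
-- only a double negation in the last case.
⌜⌝-homo-neg : ∀ i → ⌜ ℤ.- i ⌝ ≡ ℚ.- ⌜ i ⌝
⌜⌝-homo-neg (+ zero)    = refl
⌜⌝-homo-neg (+ suc n)   = refl
⌜⌝-homo-neg -[1+ n ]    = sym (GroupProperties.⁻¹-involutive ℚ.+-0-group ⌜ + suc n ⌝)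

⌜⌝-homo-- : ∀ i j → ⌜ i ℤ.- j ⌝ ≡ ⌜ i ⌝ - ⌜ j ⌝
⌜⌝-homo-- i j = trans (⌜⌝-homo-+ i (ℤ.- j)) (cong (⌜ i ⌝ ℚ.+_) (⌜⌝-homo-neg j))

⌜⌝-cancel-≤ : ∀ {i j} → ⌜ i ⌝ ≤ ⌜ j ⌝ → i ℤ.≤ j
⌜⌝-cancel-≤ {i} {j} i≤j
  with ℚᵘ.≤-respʳ-≃ (ℚ.toℚᵘ-fromℚᵘ (mkℚᵘ j 0))
         (ℚᵘ.≤-respˡ-≃ (ℚ.toℚᵘ-fromℚᵘ (mkℚᵘ i 0)) (ℚ.toℚᵘ-mono-≤ i≤j))
... | *≤* i*1≤j*1 = subst₂ ℤ._≤_ (ℤ.*-identityʳ i) (ℤ.*-identityʳ j) i*1≤j*1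

floor-⌜+⌝ : ∀ n → floor ⌜ + n ⌝ ≡ + n
floor-⌜+⌝ n = begin
  -- On the explicit fraction with denominator 1, `floor` computes to a natural-number division by
  -- 1.
  floor ⌜ + n ⌝                          ≡⟨ cong floor (ℚ.↥p/↧p≡p (mkℚ (+ n) 0 coprime)) ⟩
  1ℤ ℤ.* (+ (n ℕ./ 1))                   ≡⟨ ℤ.*-identityˡ (+ (n ℕ./ 1)) ⟩
  + (n ℕ./ 1)                            ≡⟨ cong +_ (ℕ.n/1≡n n) ⟩
  + n                                    ∎
  where
  open ≡-Reasoning
  coprime = Coprime.sym (Coprime.1-coprimeTo n)

-- The fractional part is 0, hence below `½`, so neither the tie nor the upward branch can be taken.
roundEven-fixed : ∀ p → ⌜ floor p ⌝ ≡ p → roundEven p ≡ floor p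
roundEven-fixed p ⌜⌊p⌋⌝≡p
  with frac≡0 ← trans (cong (p -_) ⌜⌊p⌋⌝≡p) (ℚ.+-inverseʳ p)
  with ℚ.<-cmp (p - ⌜ floor p ⌝) ½
... | tri< _ _ _  = refl
... | tri≈ ≮½ _ _ = contradiction (subst (_< ½) (sym frac≡0) (ℚ.positive⁻¹ ½)) ≮½
... | tri> ≮½ _ _ = contradiction (subst (_< ½) (sym frac≡0) (ℚ.positive⁻¹ ½)) ≮½

roundEven-⌜+⌝ : ∀ n → roundEven ⌜ + n ⌝ ≡ + n
roundEven-⌜+⌝ n = trans (roundEven-fixed ⌜ + n ⌝ (cong ⌜_⌝ (floor-⌜+⌝ n))) (floor-⌜+⌝ n)

-- Powers of two and dyadics

1/n≡[1/2n]*2 : ∀ n .{{_ : NonZero n}} → let instance _ = ℕ.m*n≢0 2 n in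
       (1ℤ / n) ≡ (1ℤ / (2 ℕ.* n)) * ⌜ + 2 ⌝
1/n≡[1/2n]*2 n@(suc _) = sym (trans (fromℚᵘ-homo-* (mkℚᵘ 1ℤ (ℕ.pred (2 ℕ.* n))) (mkℚᵘ (+ 2) 0))
  (ℚ.fromℚᵘ-cong {mkℚᵘ 1ℤ (ℕ.pred (2 ℕ.* n)) ℚᵘ.* mkℚᵘ (+ 2) 0} {mkℚᵘ 1ℤ (ℕ.pred n)} (*≡* (cong +_ (lemma n)))))
  where
  lemma : ∀ n → 2 ℕ.* n ≡ 1 ℕ.* (2 ℕ.* n ℕ.* 1)
  lemma n = sym (trans (ℕ.*-identityˡ _) (ℕ.*-identityʳ _))

-- The exponent -1 is a case of its own, because there `2^_` passes from reciprocals to integer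
-- powers.
2^-suc : ∀ q → 2^ (ℤ.suc q) ≡ 2^ q * ⌜ + 2 ⌝
2^-suc (+ n)        = trans (cong ⌜_⌝ (trans (cong +_ (ℕ.*-comm 2 (2 ^ n))) (ℤ.pos-* (2 ^ n) 2))) (⌜⌝-homo-* (+ (2 ^ n)) (+ 2))
2^-suc -[1+ zero ]  = refl
2^-suc -[1+ suc n ] = 1/n≡[1/2n]*2 (2 ^ suc n) {{ℕ.m^n≢0 2 (suc n)}}

2^-+ : ∀ q n → 2^ (q ℤ.+ + n) ≡ 2^ q * ⌜ + (2 ^ n) ⌝
2^-+ q zero    = trans (cong 2^_ (ℤ.+-identityʳ q)) (sym (ℚ.*-identityʳ (2^ q)))
2^-+ q (suc n) = begin
  2^ (q ℤ.+ + suc n)                        ≡⟨ cong 2^_ (swap q (+ n)) ⟩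
  2^ (ℤ.suc (q ℤ.+ + n))                    ≡⟨ 2^-suc (q ℤ.+ + n) ⟩
  2^ (q ℤ.+ + n) * ⌜ + 2 ⌝                  ≡⟨ cong (_* ⌜ + 2 ⌝) (2^-+ q n) ⟩
  2^ q * ⌜ + (2 ^ n) ⌝ * ⌜ + 2 ⌝            ≡⟨ ℚ.*-assoc (2^ q) _ _ ⟩
  2^ q * (⌜ + (2 ^ n) ⌝ * ⌜ + 2 ⌝)          ≡⟨ cong (2^ q *_) (2^-suc (+ n)) ⟨
  2^ q * ⌜ + (2 ^ suc n) ⌝                  ∎
  where
  open ≡-Reasoning
  swap : ∀ q i → q ℤ.+ (1ℤ ℤ.+ i) ≡ 1ℤ ℤ.+ (q ℤ.+ i)
  swap q i = trans (sym (ℤ.+-assoc q 1ℤ i)) (trans (cong (ℤ._+ i) (ℤ.+-comm q 1ℤ)) (ℤ.+-assoc 1ℤ q i))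

2^-positive : ∀ q → ℚ.Positive (2^ q)
2^-positive (+ n)    = ℚ.normalize-pos (2 ^ n) 1 {{_}} {{ℕ.m^n≢0 2 n}}
2^-positive -[1+ n ] = ℚ.normalize-pos 1 (2 ^ suc n) {{ℕ.m^n≢0 2 (suc n)}}

open Dyadic

i+[j-i]≡j : ∀ i j → i ℤ.+ (j ℤ.- i) ≡ j
i+[j-i]≡j = ℤ-Ring.solve-∀

t+∣q-t∣≡q : ∀ {t q} → t ℤ.≤ q → t ℤ.+ + ℤ.∣ q ℤ.- t ∣ ≡ q
t+∣q-t∣≡q {t} {q} t≤q =
  trans (cong (ℤ._+_ t) (ℤ.0≤i⇒+∣i∣≡i (ℤ.i≤j⇒0≤j-i t≤q))) (i+[j-i]≡j t q)

◃-*-pos : ∀ s m n → s ◃ (m ℕ.* n) ≡ (s ◃ m) ℤ.* + n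
◃-*-pos s m n = begin
  s ◃ (m ℕ.* n)                  ≡⟨ cong (_◃ (m ℕ.* n)) (*-identityʳ s) ⟨
  (s Sign.* Sign.+) ◃ (m ℕ.* n)  ≡⟨ ℤ.◃-distrib-* s Sign.+ m n ⟩
  (s ◃ m) ℤ.* (Sign.+ ◃ n)       ≡⟨ cong ((s ◃ m) ℤ.*_) (ℤ.+◃n≡+n n) ⟩
  (s ◃ m) ℤ.* + n                ∎
  where open ≡-Reasoning

-- Since `t` is at most the exponent, the absolute value in `scaleTo` changes nothing and the unit
-- `2^ t` divides the value exactly.
⟦⟧-scaleTo : ∀ t d → t ℤ.≤ exponent d → ⟦ d ⟧ ≡ ⌜ scaleTo t d ⌝ * 2^ t
⟦⟧-scaleTo t (dyadic s m q) t≤q = begin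
  ⌜ s ◃ m ⌝ * 2^ q                         ≡⟨ cong (λ z → ⌜ s ◃ m ⌝ * 2^ z) (t+∣q-t∣≡q t≤q) ⟨
  ⌜ s ◃ m ⌝ * 2^ (t ℤ.+ + k)               ≡⟨ cong (⌜ s ◃ m ⌝ *_) (trans (2^-+ t k) (ℚ.*-comm (2^ t) _)) ⟩
  ⌜ s ◃ m ⌝ * (⌜ + (2 ^ k) ⌝ * 2^ t)       ≡⟨ ℚ.*-assoc ⌜ s ◃ m ⌝ _ _ ⟨
  ⌜ s ◃ m ⌝ * ⌜ + (2 ^ k) ⌝ * 2^ t         ≡⟨ cong (_* 2^ t) (⌜⌝-homo-* (s ◃ m) _) ⟨
  ⌜ (s ◃ m) ℤ.* + (2 ^ k) ⌝ * 2^ t         ≡⟨ cong (λ z → ⌜ z ⌝ * 2^ t) (◃-*-pos s m (2 ^ k)) ⟨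
  ⌜ s ◃ (m ℕ.* 2 ^ k) ⌝ * 2^ t             ∎
  where
  open ≡-Reasoning
  k = ℤ.∣ q ℤ.- t ∣

-- The IEEE sign of an exact zero disappears here, as `s ◃ 0` is `0ℤ` for either sign.
diffSign-◃ : ∀ s₁ s₂ n → diffSign s₁ s₂ n ◃ ℤ.∣ n ∣ ≡ n
diffSign-◃ s₁ s₂ (+ zero)  = refl
diffSign-◃ s₁ s₂ (+ suc n) = refl
diffSign-◃ s₁ s₂ -[1+ n ]  = refl

⟦⟧-⊖ : ∀ d₁ d₂ → ⟦ d₁ ⊖ d₂ ⟧ ≡ ⟦ d₁ ⟧ - ⟦ d₂ ⟧
⟦⟧-⊖ d₁ d₂ = begin
  ⟦ d₁ ⊖ d₂ ⟧                                       ≡⟨ cong (λ z → ⌜ z ⌝ * 2^ t) (diffSign-◃ (sign d₁) (sign d₂) (X ℤ.- Y)) ⟩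
  ⌜ X ℤ.- Y ⌝ * 2^ t                                ≡⟨ cong (_* 2^ t) (⌜⌝-homo-- X Y) ⟩
  (⌜ X ⌝ - ⌜ Y ⌝) * 2^ t                            ≡⟨ ℚ.*-distribʳ-+ (2^ t) ⌜ X ⌝ (ℚ.- ⌜ Y ⌝) ⟩
  ⌜ X ⌝ * 2^ t ℚ.+ (ℚ.- ⌜ Y ⌝) * 2^ t               ≡⟨ cong (⌜ X ⌝ * 2^ t ℚ.+_) (ℚ.neg-distribˡ-* ⌜ Y ⌝ (2^ t)) ⟨
  ⌜ X ⌝ * 2^ t - ⌜ Y ⌝ * 2^ t                       ≡⟨ cong₂ _-_ (⟦⟧-scaleTo t d₁ (ℤ.i⊓j≤i _ _)) (⟦⟧-scaleTo t d₂ (ℤ.i⊓j≤j (exponent d₁) _)) ⟨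
  ⟦ d₁ ⟧ - ⟦ d₂ ⟧                                   ∎
  where
  open ≡-Reasoning
  t = exponent d₁ ℤ.⊓ exponent d₂
  X = scaleTo t d₁
  Y = scaleTo t d₂

-- Binary logarithm

2*⌊n/2⌋≤n : ∀ n → 2 ℕ.* ⌊ n /2⌋ ℕ.≤ n
2*⌊n/2⌋≤n n = begin
  2 ℕ.* ⌊ n /2⌋          ≡⟨ cong (⌊ n /2⌋ ℕ.+_) (ℕ.+-identityʳ _) ⟩
  ⌊ n /2⌋ ℕ.+ ⌊ n /2⌋    ≤⟨ ℕ.+-monoʳ-≤ ⌊ n /2⌋ (ℕ.⌊n/2⌋≤⌈n/2⌉ n) ⟩
  ⌊ n /2⌋ ℕ.+ ⌈ n /2⌉    ≡⟨ ℕ.⌊n/2⌋+⌈n/2⌉≡n n ⟩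
  n                      ∎
  where open ℕ.≤-Reasoning

-- Strong induction by halving: passing from `n` to `⌊ n /2⌋` lowers the logarithm by one.
2^⌊log₂n⌋≤n : ∀ n .{{_ : NonZero n}} → 2 ^ ⌊log₂ n ⌋ ℕ.≤ n
2^⌊log₂n⌋≤n n = <-rec (λ n → .{{_ : NonZero n}} → 2 ^ ⌊log₂ n ⌋ ℕ.≤ n) step n
  where
  step : ∀ n → (∀ {m} → m ℕ.< n → .{{_ : NonZero m}} → 2 ^ ⌊log₂ m ⌋ ℕ.≤ m) →
         .{{_ : NonZero n}} → 2 ^ ⌊log₂ n ⌋ ℕ.≤ n
  step 1               rec = ℕ.≤-refl
  step n@(suc (suc k)) rec = begin
    2 ^ ⌊log₂ n ⌋                  ≤⟨ ℕ.^-monoʳ-≤ 2 (ℕ.m≤n+m∸n ⌊log₂ n ⌋ 1) ⟩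
    2 ^ suc (⌊log₂ n ⌋ ∸ 1)        ≡⟨ cong (λ z → 2 ^ suc z) (⌊log₂⌊n/2⌋⌋≡⌊log₂n⌋∸1 n) ⟨
    2 ^ suc ⌊log₂ ⌊ n /2⌋ ⌋        ≤⟨ ℕ.*-monoʳ-≤ 2 (rec (ℕ.⌊n/2⌋<n (suc k))) ⟩
    2 ℕ.* ⌊ n /2⌋                  ≤⟨ 2*⌊n/2⌋≤n n ⟩
    n                              ∎
    where open ℕ.≤-Reasoning

-- Otherwise monotonicity of the logarithm would give `suc ⌊log₂ n ⌋ ≤ ⌊log₂ n ⌋`.
n<2^[1+⌊log₂n⌋] : ∀ n → n ℕ.< 2 ^ suc ⌊log₂ n ⌋
n<2^[1+⌊log₂n⌋] n = ℕ.≰⇒> λ 2^≤n → ℕ.1+n≰n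
  (subst (ℕ._≤ ⌊log₂ n ⌋) (⌊log₂[2^n]⌋≡n (suc ⌊log₂ n ⌋)) (⌊log₂⌋-mono-≤ 2^≤n))

2^-cancel-< : ∀ {m n} → 2 ^ m ℕ.< 2 ^ n → m ℕ.< n
2^-cancel-< 2^m<2^n = ℕ.≰⇒> λ n≤m → ℕ.<⇒≱ 2^m<2^n (ℕ.^-monoʳ-≤ 2 n≤m)

-- Encoded words

fromBits-< : ∀ {n} (bs : Vec Bool n) → fromBits bs ℕ.< 2 ^ n
fromBits-<         []       = ℕ.s≤s z≤n
fromBits-< {suc n} (b ∷ bs) =
  subst (fromBits (b ∷ bs) ℕ.<_) (cong (2 ^ n ℕ.+_) (sym (ℕ.+-identityʳ (2 ^ n))))
    (ℕ.+-mono-≤-< (bit*k≤k b) (fromBits-< bs))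
  where
  bit*k≤k : ∀ b → fromBit b ℕ.* 2 ^ n ℕ.≤ 2 ^ n
  bit*k≤k false = z≤n
  bit*k≤k true  = ℕ.≤-reflexive (ℕ.*-identityˡ (2 ^ n))

fromSignBit-toSignBit : ∀ s → fromSignBit (toSignBit s) ≡ s
fromSignBit-toSignBit Sign.+ = refl
fromSignBit-toSignBit Sign.- = refl

module _ (F : IEEEFormat) where
  open IEEEFormat F hiding (Word)

  private
    -- The exponents of the unit in the last place in the lowest and in the highest finite binade.
    emin emax : ℤ
    emin = 1ℤ ℤ.- + bias ℤ.- + fw
    emax = + bias ℤ.- + fw

  suc-bias : suc bias ≡ 2 ^ (ew ∸ 1)
  suc-bias = ℕ.m+[n∸m]≡n (ℕ.m^n>0 2 (ew ∸ 1))

  suc-maxE : suc maxE ≡ 2 ^ ew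
  suc-maxE = ℕ.m+[n∸m]≡n (ℕ.m^n>0 2 ew)

  0<bias : 0 ℕ.< bias
  0<bias = ℕ.s≤s⁻¹ (subst (2 ℕ.≤_) (sym suc-bias) (ℕ.^-monoʳ-≤ 2 (ℕ.∸-monoˡ-≤ 1 2≤ew)))

  -- The largest finite exponent field is thus `bias + bias`, which decodes to the exponent `emax`.
  maxE≡1+2*bias : maxE ≡ suc (bias ℕ.+ bias)
  maxE≡1+2*bias = ℕ.suc-injective (begin
    suc maxE                         ≡⟨ suc-maxE ⟩
    2 ^ ew                           ≡⟨ cong (2 ^_) (ℕ.m+[n∸m]≡n (ℕ.≤-trans (s≤s z≤n) 2≤ew)) ⟨
    2 ℕ.* 2 ^ (ew ∸ 1)               ≡⟨ cong (2 ℕ.*_) suc-bias ⟨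
    2 ℕ.* suc bias                   ≡⟨ cong (suc bias ℕ.+_) (ℕ.+-identityʳ _) ⟩
    suc bias ℕ.+ suc bias            ≡⟨ cong suc (ℕ.+-suc bias bias) ⟩
    suc (suc (bias ℕ.+ bias))        ∎)
    where open ≡-Reasoning

  -- `decode` takes its finiteness proof irrelevantly, so the proof found by `isFinite?` serves as
  -- well as the given one.
  val-finite : ∀ w (fin : IsFinite F w) → val F w ≡ ⟦ decode F w fin ⟧
  val-finite w fin with isFinite? F w
  ... | yes _   = refl
  ... | no ¬fin = contradiction fin ¬fin

  finite⇒E≢maxE : ∀ w → IsFinite F w → exponentField F w ≢ maxE
  finite⇒E≢maxE w fin E≡maxE with fractionField F w ℕ.≟ 0
  ... | yes M≡0 = fin (inj₁ (E≡maxE , M≡0))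
  ... | no  M≢0 = fin (inj₂ (E≡maxE , M≢0))

  E≢maxE⇒finite : ∀ w → exponentField F w ≢ maxE → IsFinite F w
  E≢maxE⇒finite w E≢maxE (inj₁ (E≡maxE , _)) = E≢maxE E≡maxE
  E≢maxE⇒finite w E≢maxE (inj₂ (E≡maxE , _)) = E≢maxE E≡maxE

  -- The bound on `E` does two things: the field fits in `ew` bits, and the packed word is finite.
  val-pack : ∀ s {E M} → E ℕ.< maxE → M ℕ.< 2 ^ fw → val F (pack F s E M) ≡ ⟦ decodeFields F s E M ⟧
  val-pack s {E} {M} E<maxE M<2^fw = trans (val-finite w fin)
    (trans (cong (λ s → ⟦ decodeFields F s (exponentField F w) (fractionField F w) ⟧) (fromSignBit-toSignBit s))
           (cong₂ (λ E M → ⟦ decodeFields F s E M ⟧) E≡ M≡))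
    where
    w = pack F s E M
    fields = toBits ew E ++ toBits fw M
    split = ++-injective (take ew fields) (toBits ew E) (take++drop≡id ew fields)
    E≡ : exponentField F w ≡ E
    E≡ = trans (cong fromBits (proj₁ split))
               (fromBits-toBits ew (ℕ.<-trans E<maxE (ℕ.≤-reflexive suc-maxE)))
    M≡ : fractionField F w ≡ M
    M≡ = trans (cong fromBits (proj₂ split)) (fromBits-toBits fw M<2^fw)
    fin : IsFinite F w
    fin = E≢maxE⇒finite w λ E≡maxE → ℕ.<⇒≢ E<maxE (trans (sym E≡) E≡maxE)

  -- A sufficient condition for exact representability. The significand may have leading zeros, so
  -- differences that lose high bits still qualify.
  record InRange (d : Dyadic) : Set where
    constructor inRange
    field
      significand< : significand d ℕ.< 2 ^ suc fw
      emin≤        : emin ℤ.≤ exponent d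
      ≤emax        : exponent d ℤ.≤ emax

  decodeFields-inRange : ∀ s {E M} → E ℕ.< maxE → M ℕ.< 2 ^ fw → InRange (decodeFields F s E M)
  decodeFields-inRange s {zero}  {M} E<maxE M<2^fw = inRange
    (ℕ.<-≤-trans M<2^fw (ℕ.^-monoʳ-≤ 2 (ℕ.n≤1+n fw)))
    ℤ.≤-refl
    -- `emin ≤ emax` reduces to 1 - b ≤ 1 ≤ b; the second inequality rests on `2≤ew`.
    (ℤ.+-monoˡ-≤ (ℤ.- + fw) (ℤ.≤-trans (ℤ.i-j≤i 1ℤ (+ bias)) (ℤ.+≤+ 0<bias)))
  decodeFields-inRange s {suc e} {M} E<maxE M<2^fw = inRange
    (subst (2 ^ fw ℕ.+ M ℕ.<_) (cong (2 ^ fw ℕ.+_) (sym (ℕ.+-identityʳ (2 ^ fw))))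
           (ℕ.+-monoʳ-< (2 ^ fw) M<2^fw))
    (ℤ.+-monoˡ-≤ (ℤ.- + fw) (ℤ.+-monoˡ-≤ (ℤ.- + bias) (ℤ.+≤+ (s≤s z≤n))))
    (ℤ.+-monoˡ-≤ (ℤ.- + fw) (subst (+ suc e ℤ.- + bias ℤ.≤_) (cancel (+ bias))
       (ℤ.+-monoˡ-≤ (ℤ.- + bias) (ℤ.+≤+ (ℕ.s≤s⁻¹ (subst (suc e ℕ.<_) maxE≡1+2*bias E<maxE))))))
    where
    cancel : ∀ b → b ℤ.+ b ℤ.- b ≡ b
    cancel = ℤ-Ring.solve-∀

  decode-inRange : ∀ w (fin : IsFinite F w) → InRange (decode F w fin)
  decode-inRange w fin = decodeFields-inRange (signField F w)
    (ℕ.≤∧≢⇒< (ℕ.s≤s⁻¹ (subst (exponentField F w ℕ.<_) (sym suc-maxE) (fromBits-< (take ew (tail w)))))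
             (finite⇒E≢maxE w fin))
    (fromBits-< (drop ew (tail w)))

  -- Exactness of rounding on dyadics in range

  roundTo-exact : ∀ m {q t} → t ℤ.≤ q → roundTo F m q t ≡ m ℕ.* 2 ^ ℤ.∣ q ℤ.- t ∣
  roundTo-exact m {q} {t} t≤q = begin
    ℤ.∣ roundEven (⌜ + m ⌝ * 2^ (q ℤ.- t)) ∣       ≡⟨ cong (λ z → ℤ.∣ roundEven (⌜ + m ⌝ * 2^ z) ∣) (ℤ.0≤i⇒+∣i∣≡i (ℤ.i≤j⇒0≤j-i t≤q)) ⟨
    ℤ.∣ roundEven (⌜ + m ⌝ * ⌜ + (2 ^ k) ⌝) ∣      ≡⟨ cong (λ z → ℤ.∣ roundEven z ∣) (⌜⌝-homo-* (+ m) (+ (2 ^ k))) ⟨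
    ℤ.∣ roundEven ⌜ + m ℤ.* + (2 ^ k) ⌝ ∣          ≡⟨ cong (λ z → ℤ.∣ roundEven ⌜ z ⌝ ∣) (ℤ.pos-* m (2 ^ k)) ⟨
    ℤ.∣ roundEven ⌜ + (m ℕ.* 2 ^ k) ⌝ ∣            ≡⟨ cong ℤ.∣_∣ (roundEven-⌜+⌝ (m ℕ.* 2 ^ k)) ⟩
    m ℕ.* 2 ^ k                                    ∎
    where
    open ≡-Reasoning
    k = ℤ.∣ q ℤ.- t ∣

  module _ (s : Sign) (m : ℕ) (q : ℤ) .{{_ : NonZero m}} (d∈F : InRange (dyadic s m q)) where
    open InRange d∈F

    private
      L : ℕ
      L = ⌊log₂ m ⌋

      l : ℤ
      l = + L ℤ.+ q

      L≤fw : L ℕ.≤ fw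
      L≤fw = ℕ.s≤s⁻¹ (2^-cancel-< (ℕ.≤-<-trans (2^⌊log₂n⌋≤n m) significand<))

      m*2^k<2^[1+L+k] : ∀ k → m ℕ.* 2 ^ k ℕ.< 2 ^ (suc L ℕ.+ k)
      m*2^k<2^[1+L+k] k = subst (m ℕ.* 2 ^ k ℕ.<_) (sym (ℕ.^-distribˡ-+-* 2 (suc L) k))
        (ℕ.*-monoˡ-< (2 ^ k) {{ℕ.m^n≢0 2 k}} (n<2^[1+⌊log₂n⌋] m))

      2^[L+k]≤m*2^k : ∀ k → 2 ^ (L ℕ.+ k) ℕ.≤ m ℕ.* 2 ^ k
      2^[L+k]≤m*2^k k = subst (ℕ._≤ m ℕ.* 2 ^ k) (sym (ℕ.^-distribˡ-+-* 2 L k))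
        (ℕ.*-monoˡ-≤ (2 ^ k) (2^⌊log₂n⌋≤n m))

    -- In units of `2^ emin` the significand has `suc L + k` bits, and `l < 1 - b` makes this at
    -- most `fw`. The result therefore stays below `2 ^ fw` and is not promoted to the least normal
    -- number.
    packSubnormal-exact : l ℤ.< 1ℤ ℤ.- + bias →
                          val F (packSubnormal F s (roundTo F m q emin)) ≡ ⟦ dyadic s m q ⟧
    packSubnormal-exact l<1-b = begin
      val F (packSubnormal F s (roundTo F m q emin))  ≡⟨ cong (λ k → val F (packSubnormal F s k)) (roundTo-exact m emin≤) ⟩
      val F (packSubnormal F s K)                     ≡⟨ cong (λ b → val F (if b then pack F s 1 0 else pack F s 0 K)) (dec-false (K ℕ.≟ 2 ^ fw) (ℕ.<⇒≢ K<2^fw)) ⟩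
      val F (pack F s 0 K)                            ≡⟨ val-pack s (subst (0 ℕ.<_) (sym maxE≡1+2*bias) (s≤s z≤n)) K<2^fw ⟩
      ⟦ dyadic s K emin ⟧                             ≡⟨ ⟦⟧-scaleTo emin (dyadic s m q) emin≤ ⟨
      ⟦ dyadic s m q ⟧                                ∎
      where
      open ≡-Reasoning
      k = ℤ.∣ q ℤ.- emin ∣
      K = m ℕ.* 2 ^ k

      -- `o` is instantiated at `1ℤ`, and `1ℤ + + L` is definitionally `+ suc L`.
      regroup : ∀ L q b f o → (o ℤ.+ L) ℤ.+ (q ℤ.- (o ℤ.- b ℤ.- f)) ≡ (o ℤ.+ (L ℤ.+ q)) ℤ.+ (b ℤ.+ f ℤ.- o)
      regroup = ℤ-Ring.solve-∀

      cancel : ∀ b f o → (o ℤ.- b) ℤ.+ (b ℤ.+ f ℤ.- o) ≡ f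
      cancel = ℤ-Ring.solve-∀

      -- This is `1 + l ≤ 1 - b` with `b + fw - 1` added to both sides.
      1+L+k≤fw : suc L ℕ.+ k ℕ.≤ fw
      1+L+k≤fw = ℤ.drop‿+≤+ (subst₂ ℤ._≤_
        (sym (trans (cong (λ z → + suc L ℤ.+ z) (ℤ.0≤i⇒+∣i∣≡i (ℤ.i≤j⇒0≤j-i emin≤)))
                    (regroup (+ L) q (+ bias) (+ fw) 1ℤ)))
        (cancel (+ bias) (+ fw) 1ℤ)
        (ℤ.+-monoˡ-≤ (+ bias ℤ.+ + fw ℤ.- 1ℤ) (ℤ.i<j⇒suc[i]≤j l<1-b)))

      K<2^fw : K ℕ.< 2 ^ fw
      K<2^fw = ℕ.<-≤-trans (m*2^k<2^[1+L+k] k) (ℕ.^-monoʳ-≤ 2 1+L+k≤fw)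

    -- The shift is `k = fw - L`, so `K` has exactly `fw + 1` bits: it does not renormalise, and
    -- removing its leading bit leaves a fraction field. The bounds on `l` place `E` strictly
    -- between 0 and `maxE`.
    packNormal-exact : 1ℤ ℤ.- + bias ℤ.≤ l →
                       val F (packNormal F s (roundTo F m q (l ℤ.- + fw)) l) ≡ ⟦ dyadic s m q ⟧
    packNormal-exact 1-b≤l = begin
      val F (packNormal F s (roundTo F m q t) l)      ≡⟨ cong (λ k → val F (packNormal F s k l)) (roundTo-exact m t≤q) ⟩
      val F (packNormal F s K l)                      ≡⟨ cong (λ b → val F (if b then packChecked F s (2 ^ fw) (l ℤ.+ 1ℤ) else packChecked F s K l)) (dec-false (K ℕ.≟ 2 ^ suc fw) (ℕ.<⇒≢ K<2^[1+fw])) ⟩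
      val F (packChecked F s K l)                     ≡⟨ cong (λ b → val F (if b then infinity F s else pack F s E (K ∸ 2 ^ fw))) (dec-false (+ bias ℤ.<? l) (ℤ.≤⇒≯ l≤b)) ⟩
      val F (pack F s E (K ∸ 2 ^ fw))                 ≡⟨ val-pack s E<maxE K∸2^fw<2^fw ⟩
      ⟦ decodeFields F s E (K ∸ 2 ^ fw) ⟧             ≡⟨ cong ⟦_⟧ (decodeFields-normal E 1≤E) ⟩
      ⟦ dyadic s (2 ^ fw ℕ.+ (K ∸ 2 ^ fw)) (+ E ℤ.- + bias ℤ.- + fw) ⟧  ≡⟨ cong₂ (λ k l → ⟦ dyadic s k (l ℤ.- + fw) ⟧) (ℕ.m+[n∸m]≡n 2^fw≤K) E-b≡l ⟩
      ⟦ dyadic s K t ⟧                                ≡⟨ ⟦⟧-scaleTo t (dyadic s m q) t≤q ⟨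
      ⟦ dyadic s m q ⟧                                ∎
      where
      open ≡-Reasoning
      t = l ℤ.- + fw
      k = ℤ.∣ q ℤ.- t ∣
      K = m ℕ.* 2 ^ k
      E = ℤ.∣ l ℤ.+ + bias ∣

      -- `decodeFields` does not reduce on the absolute value `E`; knowing it positive selects the
      -- normal case.
      decodeFields-normal : ∀ E {M} → 1 ℕ.≤ E →
        decodeFields F s E M ≡ dyadic s (2 ^ fw ℕ.+ M) (+ E ℤ.- + bias ℤ.- + fw)
      decodeFields-normal (suc _) _ = refl

      q-t≡fw-L : ∀ L q f → q ℤ.- (L ℤ.+ q ℤ.- f) ≡ f ℤ.- L
      q-t≡fw-L = ℤ-Ring.solve-∀

      t≤q : t ℤ.≤ q
      t≤q = ℤ.0≤i-j⇒j≤i (subst (0ℤ ℤ.≤_) (sym (q-t≡fw-L (+ L) q (+ fw)))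
                                 (ℤ.i≤j⇒0≤j-i (ℤ.+≤+ L≤fw)))

      L+k≡fw : L ℕ.+ k ≡ fw
      L+k≡fw = ℤ.+-injective (trans
        (cong (λ z → + L ℤ.+ z) (trans (ℤ.0≤i⇒+∣i∣≡i (ℤ.i≤j⇒0≤j-i t≤q)) (q-t≡fw-L (+ L) q (+ fw))))
        (i+[j-i]≡j (+ L) (+ fw)))

      K<2^[1+fw] : K ℕ.< 2 ^ suc fw
      K<2^[1+fw] = subst (λ n → K ℕ.< 2 ^ suc n) L+k≡fw (m*2^k<2^[1+L+k] k)

      2^fw≤K : 2 ^ fw ℕ.≤ K
      2^fw≤K = subst (λ n → 2 ^ n ℕ.≤ K) L+k≡fw (2^[L+k]≤m*2^k k)

      K∸2^fw<2^fw : K ∸ 2 ^ fw ℕ.< 2 ^ fw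
      K∸2^fw<2^fw = ℕ.+-cancelˡ-< (2 ^ fw) _ _ (subst₂ ℕ._<_ (sym (ℕ.m+[n∸m]≡n 2^fw≤K))
        (cong (2 ^ fw ℕ.+_) (ℕ.+-identityʳ (2 ^ fw))) K<2^[1+fw])

      -- Overflow is excluded here, by adding `L ≤ fw` and `q ≤ b - fw`.
      l≤b : l ℤ.≤ + bias
      l≤b = subst (l ℤ.≤_) (i+[j-i]≡j (+ fw) (+ bias)) (ℤ.+-mono-≤ (ℤ.+≤+ L≤fw) ≤emax)

      1-b+b : ∀ b o → o ℤ.- b ℤ.+ b ≡ o
      1-b+b = ℤ-Ring.solve-∀

      l+b-b : ∀ l b → l ℤ.+ b ℤ.- b ≡ l
      l+b-b = ℤ-Ring.solve-∀

      1≤l+b : 1ℤ ℤ.≤ l ℤ.+ + bias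
      1≤l+b = subst (ℤ._≤ l ℤ.+ + bias) (1-b+b (+ bias) 1ℤ) (ℤ.+-monoˡ-≤ (+ bias) 1-b≤l)

      +E≡l+b : + E ≡ l ℤ.+ + bias
      +E≡l+b = ℤ.0≤i⇒+∣i∣≡i (ℤ.≤-trans (ℤ.+≤+ z≤n) 1≤l+b)

      1≤E : 1 ℕ.≤ E
      1≤E = ℤ.drop‿+≤+ (subst (1ℤ ℤ.≤_) (sym +E≡l+b) 1≤l+b)

      E<maxE : E ℕ.< maxE
      E<maxE = subst (E ℕ.<_) (sym maxE≡1+2*bias) (s≤s (ℤ.drop‿+≤+
        (subst (ℤ._≤ + (bias ℕ.+ bias)) (sym +E≡l+b) (ℤ.+-monoˡ-≤ (+ bias) l≤b))))

      E-b≡l : + E ℤ.- + bias ≡ l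
      E-b≡l = trans (cong (ℤ._- + bias) +E≡l+b) (l+b-b l (+ bias))

  roundDyadic-exact : ∀ d → InRange d → val F (roundDyadic F d) ≡ ⟦ d ⟧
  roundDyadic-exact (dyadic s zero q) d∈F = begin
    -- The packed zero decodes with exponent `emin` rather than `q`, so the two sides are compared
    -- through `0ℚ`.
    val F (pack F s 0 0)        ≡⟨ val-pack s (subst (0 ℕ.<_) (sym maxE≡1+2*bias) (s≤s z≤n)) (ℕ.m^n>0 2 fw) ⟩
    ⌜ 0ℤ ⌝ * 2^ emin            ≡⟨ ℚ.*-zeroˡ (2^ emin) ⟩
    0ℚ                          ≡⟨ ℚ.*-zeroˡ (2^ q) ⟨
    ⌜ 0ℤ ⌝ * 2^ q               ∎
    where open ≡-Reasoning
  roundDyadic-exact d@(dyadic s m@(suc _) q) d∈F =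
    if-does-elim (λ w → val F w ≡ ⟦ d ⟧) (+ ⌊log₂ m ⌋ ℤ.+ q ℤ.<? 1ℤ ℤ.- + bias)
      (packSubnormal-exact s m q d∈F)
      (λ l≮1-b → packNormal-exact s m q d∈F (ℤ.≮⇒≥ l≮1-b))

-- Sterbenz's bound on the difference

-- If `m ≤ n`, the distance is n - m ≤ 2m - m; if `n ≤ m`, it is m - n, at most m at once.
∣m⊖n∣≤m : ∀ {m n} → n ℕ.≤ 2 ℕ.* m → ℤ.∣ m ℤ.⊖ n ∣ ℕ.≤ m
∣m⊖n∣≤m {m} {n} n≤2m with ℕ.≤-total m n
... | inj₁ m≤n = ℕ.≤-trans (ℕ.≤-reflexive (ℤ.∣⊖∣-≤ m≤n))
  (ℕ.m≤n+o⇒m∸n≤o n m (subst (λ z → n ℕ.≤ m ℕ.+ z) (ℕ.+-identityʳ m) n≤2m))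
... | inj₂ n≤m = ℕ.≤-trans (ℕ.≤-reflexive (trans (ℤ.∣m⊖n∣≡∣n⊖m∣ m n) (ℤ.∣⊖∣-≤ n≤m)))
  (ℕ.m∸n≤m m n)

∣i-j∣≤∣i∣ : ∀ {i j} → 0ℤ ℤ.≤ i → 0ℤ ℤ.≤ j → j ℤ.≤ + 2 ℤ.* i → ℤ.∣ i ℤ.- j ∣ ℕ.≤ ℤ.∣ i ∣
∣i-j∣≤∣i∣ {+ m} {+ n} _ _ j≤2i = subst (λ z → ℤ.∣ z ∣ ℕ.≤ m) (sym (ℤ.m-n≡m⊖n m n))
  (∣m⊖n∣≤m (ℤ.drop‿+≤+ (subst (+ n ℤ.≤_) (sym (ℤ.pos-* 2 m)) j≤2i)))

scaleTo-self : ∀ d → ℤ.∣ scaleTo (exponent d) d ∣ ≡ significand d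
scaleTo-self (dyadic s m q) = begin
  ℤ.∣ s ◃ (m ℕ.* 2 ^ ℤ.∣ q ℤ.- q ∣) ∣   ≡⟨ ℤ.abs-◃ s _ ⟩
  m ℕ.* 2 ^ ℤ.∣ q ℤ.- q ∣               ≡⟨ cong (λ z → m ℕ.* 2 ^ ℤ.∣ z ∣) (ℤ.+-inverseʳ q) ⟩
  m ℕ.* 1                               ≡⟨ ℕ.*-identityʳ m ⟩
  m                                     ∎
  where open ≡-Reasoning

scaleTo-nonneg : ∀ t d → t ℤ.≤ exponent d → 0ℚ < ⟦ d ⟧ → 0ℤ ℤ.≤ scaleTo t d
scaleTo-nonneg t d t≤ 0<d = ⌜⌝-cancel-≤ (ℚ.*-cancelʳ-≤-pos (2^ t) {{2^-positive t}}
  (subst₂ _≤_ (sym (ℚ.*-zeroˡ (2^ t))) (⟦⟧-scaleTo t d t≤) (ℚ.<⇒≤ 0<d)))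

-- Both values are integer multiples of the positive `2^ t`, which cancels; this carries the
-- hypotheses of the theorem over to integers.
scaleTo-≤2* : ∀ t d₁ d₂ → t ℤ.≤ exponent d₁ → t ℤ.≤ exponent d₂ →
              ⟦ d₁ ⟧ ≤ ⌜ + 2 ⌝ * ⟦ d₂ ⟧ → scaleTo t d₁ ℤ.≤ + 2 ℤ.* scaleTo t d₂
scaleTo-≤2* t d₁ d₂ t≤q₁ t≤q₂ d₁≤2d₂ = ⌜⌝-cancel-≤ (ℚ.*-cancelʳ-≤-pos (2^ t) {{2^-positive t}}
  (subst₂ _≤_ (⟦⟧-scaleTo t d₁ t≤q₁) rhs d₁≤2d₂))
  where
  open ≡-Reasoning
  Y = scaleTo t d₂
  rhs : ⌜ + 2 ⌝ * ⟦ d₂ ⟧ ≡ ⌜ + 2 ℤ.* Y ⌝ * 2^ t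
  rhs = begin
    ⌜ + 2 ⌝ * ⟦ d₂ ⟧            ≡⟨ cong (⌜ + 2 ⌝ *_) (⟦⟧-scaleTo t d₂ t≤q₂) ⟩
    ⌜ + 2 ⌝ * (⌜ Y ⌝ * 2^ t)    ≡⟨ ℚ.*-assoc ⌜ + 2 ⌝ ⌜ Y ⌝ (2^ t) ⟨
    ⌜ + 2 ⌝ * ⌜ Y ⌝ * 2^ t      ≡⟨ cong (_* 2^ t) (⌜⌝-homo-* (+ 2) Y) ⟨
    ⌜ + 2 ℤ.* Y ⌝ * 2^ t        ∎

⊖-inRange : ∀ F d₁ d₂ → InRange F d₁ → InRange F d₂ → 0ℚ < ⟦ d₁ ⟧ → 0ℚ < ⟦ d₂ ⟧ →
            ⟦ d₁ ⟧ ≤ ⌜ + 2 ⌝ * ⟦ d₂ ⟧ → ⟦ d₂ ⟧ ≤ ⌜ + 2 ⌝ * ⟦ d₁ ⟧ → InRange F (d₁ ⊖ d₂)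
⊖-inRange F d₁ d₂ (inRange m₁< emin≤q₁ q₁≤emax) (inRange m₂< emin≤q₂ _) 0<d₁ 0<d₂ d₁≤2d₂ d₂≤2d₁ = inRange
  significand<2^
  (ℤ.⊓-glb emin≤q₁ emin≤q₂)
  (ℤ.≤-trans t≤q₁ q₁≤emax)
  where
  t = exponent d₁ ℤ.⊓ exponent d₂
  X = scaleTo t d₁
  Y = scaleTo t d₂
  t≤q₁ = ℤ.i⊓j≤i (exponent d₁) (exponent d₂)
  t≤q₂ = ℤ.i⊓j≤j (exponent d₁) (exponent d₂)
  0≤X = scaleTo-nonneg t d₁ t≤q₁ 0<d₁
  0≤Y = scaleTo-nonneg t d₂ t≤q₂ 0<d₂

  ∣X-Y∣≤∣X∣ : ℤ.∣ X ℤ.- Y ∣ ℕ.≤ ℤ.∣ X ∣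
  ∣X-Y∣≤∣X∣ = ∣i-j∣≤∣i∣ 0≤X 0≤Y (scaleTo-≤2* t d₂ d₁ t≤q₂ t≤q₁ d₂≤2d₁)

  ∣X-Y∣≤∣Y∣ : ℤ.∣ X ℤ.- Y ∣ ℕ.≤ ℤ.∣ Y ∣
  ∣X-Y∣≤∣Y∣ = subst (ℕ._≤ ℤ.∣ Y ∣) (ℤ.∣i-j∣≡∣j-i∣ Y X)
    (∣i-j∣≤∣i∣ 0≤Y 0≤X (scaleTo-≤2* t d₁ d₂ t≤q₁ t≤q₂ d₁≤2d₂))

  significand<2^ : ℤ.∣ X ℤ.- Y ∣ ℕ.< 2 ^ suc (IEEEFormat.fw F)
  -- The difference is compared with the operand whose exponent is `t`; the other one, once scaled,
  -- may reach `2 ^ suc fw`.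
  significand<2^ with ℤ.⊓-sel (exponent d₁) (exponent d₂)
  ... | inj₁ t≡q₁ = ℕ.≤-<-trans ∣X-Y∣≤∣X∣ (subst (ℕ._< _)
    (sym (trans (cong (λ t → ℤ.∣ scaleTo t d₁ ∣) t≡q₁) (scaleTo-self d₁))) m₁<)
  ... | inj₂ t≡q₂ = ℕ.≤-<-trans ∣X-Y∣≤∣Y∣ (subst (ℕ._< _)
    (sym (trans (cong (λ t → ℤ.∣ scaleTo t d₂ ∣) t≡q₂) (scaleTo-self d₂))) m₂<)

theorem3 : (F : IEEEFormat) (x y : Word F)
    (fx : IsFinite F x) (fy : IsFinite F y) →
    0ℚ < val F x → 0ℚ < val F y →
    val F x ≤ (+ 2 / 1) * val F y → val F y ≤ (+ 2 / 1) * val F x →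
    val F (refSub F x y fx fy) ≡ val F x - val F y
theorem3 F x y fx fy 0<u 0<v u≤2v v≤2u
  -- This turns the hypotheses and the right-hand side into statements about decoded dyadics;
  -- finiteness of the result comes from `roundDyadic-exact`, through `val-pack`.
  rewrite val-finite F x fx | val-finite F y fy =
  trans (roundDyadic-exact F (dx ⊖ dy)
          (⊖-inRange F dx dy (decode-inRange F x fx) (decode-inRange F y fy) 0<u 0<v u≤2v v≤2u))
        (⟦⟧-⊖ dx dy)
  where
  dx = decode F x fx
  dy = decode F y fy
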